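{- Let $k$ be a finite field with $q$ elements, let $l \ge 0$ be an integer and let $r \in k$. Then \[ |\mathcal{A}_r^l| = \frac{q^l - (-1)^l}{q+1} \quad \text{and} \quad |\mathcal{C}_r^l| = \frac{q^{l+1} + (-1)^l}{q+1}. \]
   Context: $F_k$ is the free monoid of all finite words with letters in $k$ (identity: the empty word $\varepsilon$). $\pi : F_k \to \mathrm{SL}_2(k)$ is the monoid homomorphism with $\pi(\alpha) = \begin{bmatrix} 0 & 1 \\ -1 & \alpha \end{bmatrix}$ for each letter $\alpha \in k$, so $\pi(\alpha_1\cdots\alpha_l)=\pi(\alpha_1)\cdots\pi(\alpha_l)$ and $\pi(\varepsilon)$ is the identity matrix. Let $\mathbb{P}^1(k)$ be the set of equivalence classes of $k^2\smallsetminus\{0\}$ (column vectors) under scaling by elements of $k^\times$; $\mathrm{SL}_2(k)$ acts on it by left multiplication. For $r\in k$, $\mathcal{A}_r = \left\{w \in F_k : \pi(w)\begin{bmatrix} 0 \\ 1 \end{bmatrix} = \begin{bmatrix} 1 \\ r \end{bmatrix} \text{ in } \mathbb{P}^1(k)\right\}$ and $\mathcal{C}_r = F_k\smallsetminus\mathcal{A}_r$. $F_k^l$ is the set of words of length $l$, $\mathcal{A}_r^l = F_k^l\cap\mathcal{A}_r$ and $\mathcal{C}_r^l = F_k^l\cap\mathcal{C}_r$. -}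

module Defs where

open import Algebra.Apartness.Bundles using (HeytingCommutativeRing; HeytingField)
open import Algebra.Bundles using (CommutativeRing)
open import Algebra.Definitions using (Invertible)
import Algebra.Properties.Ring as RingProperties
import Algebra.Solver.Ring.NaturalCoefficients.Default as NaturalCoefficients
open import Data.Fin using (Fin)
open import Data.List using (List; foldr; length)
import Data.List.Relation.Binary.Equality.Setoid as ListEquality
open import Data.Nat using (ℕ)
open import Data.Product using (∃; ∃-syntax; _×_; _,_; proj₁)
open import Function.Bundles using (Inverse)
open import Level using (Level; _⊔_)
import Relation.Binary.Construct.On as On
open import Relation.Binary.Bundles using (Setoid)
open import Relation.Binary.PropositionalEquality as ≡ using (_≡_)
import Relation.Binary.Reasoning.Setoid as ≈-Reasoning
open import Relation.Nullary using (¬_)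
open import Relation.Unary using (Pred; ∁; _∩_)

-- Cardinality is counted up to the equality of the setoid.
HasSize : {a ℓ : Level} → Setoid a ℓ → ℕ → Set (a ⊔ ℓ)
HasSize S n = Inverse S (≡.setoid (Fin n))

subsetoid : {a ℓ p : Level} (S : Setoid a ℓ) → Pred (Setoid.Carrier S) p → Setoid (a ⊔ p) ℓ
subsetoid S P = On.setoid {B = ∃ P} S proj₁

private
  module RingIdentities {c ℓ : Level} (S : CommutativeRing c ℓ) where
    open CommutativeRing S
    open RingProperties ring using ([y-z]x≈yx-zx)
    open NaturalCoefficients commutativeSemiring

    balance : ∀ {x y z w} → x + y ≈ w + z → x + - z ≈ w + - y
    balance {x} {y} {z} {w} p = begin
      x + - z                  ≈⟨ +-identityʳ (x + - z) ⟨
      x + - z + 0#             ≈⟨ +-cong refl (-‿inverseʳ y) ⟨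
      x + - z + (y + - y)      ≈⟨ shuffle x (- z) y (- y) ⟩
      (x + y) + (- z + - y)    ≈⟨ +-cong p refl ⟩
      (w + z) + (- z + - y)    ≈⟨ shuffle′ w z (- z) (- y) ⟩
      w + - y + (z + - z)      ≈⟨ +-cong refl (-‿inverseʳ z) ⟩
      w + - y + 0#             ≈⟨ +-identityʳ (w + - y) ⟩
      w + - y                  ∎
      where
      open ≈-Reasoning setoid
      shuffle : ∀ s t u v →
        s + t + (u + v) ≈ (s + u) + (t + v)
      shuffle = solve 4 (λ s t u v →
        s :+ t :+ (u :+ v) := (s :+ u) :+ (t :+ v)) refl
      shuffle′ : ∀ s t u v →
        (s + t) + (u + v) ≈ s + v + (t + u)
      shuffle′ = solve 4 (λ s t u v →
        (s :+ t) :+ (u :+ v) := s :+ v :+ (t :+ u)) refl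

    det-⊡ : ∀ a b c d a′ b′ c′ d′ →
      (a * a′ + b * c′) * (c * b′ + d * d′) + - ((a * b′ + b * d′) * (c * a′ + d * c′))
      ≈ (a * d + - (b * c)) * (a′ * d′ + - (b′ * c′))
    det-⊡ a b c d a′ b′ c′ d′ =
      trans (balance (lemma a b c d a′ b′ c′ d′)) (expand (a * d) (b * c) (a′ * d′) (b′ * c′))
      where
      lemma : ∀ a b c d a′ b′ c′ d′ →
        (a * a′ + b * c′) * (c * b′ + d * d′) + (a * d * (b′ * c′) + b * c * (a′ * d′))
        ≈ (a * d * (a′ * d′) + b * c * (b′ * c′)) + (a * b′ + b * d′) * (c * a′ + d * c′)
      lemma = solve 8 (λ a b c d a′ b′ c′ d′ →
        (a :* a′ :+ b :* c′) :* (c :* b′ :+ d :* d′) :+ (a :* d :* (b′ :* c′) :+ b :* c :* (a′ :* d′))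
        := (a :* d :* (a′ :* d′) :+ b :* c :* (b′ :* c′)) :+ (a :* b′ :+ b :* d′) :* (c :* a′ :+ d :* c′)) refl
      regroup : ∀ s t v w →
        s * (w + v) + t * v + t * w ≈ s * w + (s * v + t * (w + v))
      regroup = solve 4 (λ s t v w →
        s :* (w :+ v) :+ t :* v :+ t :* w := s :* w :+ (s :* v :+ t :* (w :+ v))) refl
      restore : ∀ u v → u + - v + v ≈ u
      restore u v = trans (+-assoc u (- v) v)
        (trans (+-cong refl (-‿inverseˡ v)) (+-identityʳ u))
      expand : ∀ s t u v → (s * u + t * v) + - (s * v + t * u) ≈ (s + - t) * (u + - v)
      expand s t u v = trans
        (balance (trans (+-cong (+-cong (*-cong refl (sym (restore u v))) refl) refl)
                 (trans (regroup s t v (u + - v))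
                        (+-cong refl (+-cong refl (*-cong refl (restore u v)))))))
        (sym ([y-z]x≈yx-zx (u + - v) s t))

    first : ∀ a b c d x y →
      (a * d + - (b * c)) * x ≈ d * (a * x + b * y) + - (b * (c * x + d * y))
    first a b c d x y = trans ([y-z]x≈yx-zx x (a * d) (b * c)) (balance (lemma a b c d x y))
      where
      lemma : ∀ a b c d x y →
        a * d * x + b * (c * x + d * y) ≈ d * (a * x + b * y) + b * c * x
      lemma = solve 6 (λ a b c d x y →
        a :* d :* x :+ b :* (c :* x :+ d :* y) := d :* (a :* x :+ b :* y) :+ b :* c :* x) refl

    second : ∀ a b c d x y →
      (a * d + - (b * c)) * y ≈ a * (c * x + d * y) + - (c * (a * x + b * y))
    second a b c d x y = trans ([y-z]x≈yx-zx y (a * d) (b * c)) (balance (lemma a b c d x y))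
      where
      lemma : ∀ a b c d x y →
        a * d * y + c * (a * x + b * y) ≈ a * (c * x + d * y) + b * c * y
      lemma = solve 6 (λ a b c d x y →
        a :* d :* y :+ c :* (a :* x :+ b :* y) := a :* (c :* x :+ d :* y) :+ b :* c :* y) refl

    distribute : ∀ a b s x y →
      a * (s * x) + b * (s * y) ≈ s * (a * x + b * y)
    distribute = solve 5 (λ a b s x y →
      a :* (s :* x) :+ b :* (s :* y) := s :* (a :* x :+ b :* y)) refl

-- Fields are the library's `HeytingField`. Its axioms make x # y equivalent to
-- invertibility of x - y, and irreflexivity of # rules out 0# ≈ 1#. When the
-- carrier is finite (`HasSize setoid q`), ≈ is decidable and # coincides with
-- its negation, so these are exactly the finite fields.
module OverField {c ℓ₁ ℓ₂ : Level} (k : HeytingField c ℓ₁ ℓ₂) where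

  open HeytingField k

  private
    commutativeRing : CommutativeRing c ℓ₁
    commutativeRing = HeytingCommutativeRing.commutativeRing heytingCommutativeRing

    module I = RingIdentities commutativeRing

  open RingProperties (CommutativeRing.ring commutativeRing)
    using (-0#≈0#; -‿involutive)

  IsUnit : Carrier → Set (c ⊔ ℓ₁)
  IsUnit = Invertible _≈_ 1# _*_

  record Vector₂ : Set c where
    constructor ⟨_,_⟩
    field
      x₁ x₂ : Carrier

  infix 4 _≈ᵥ_
  _≈ᵥ_ : Vector₂ → Vector₂ → Set ℓ₁
  ⟨ x₁ , x₂ ⟩ ≈ᵥ ⟨ y₁ , y₂ ⟩ = (x₁ ≈ y₁) × (x₂ ≈ y₂)

  0ᵥ : Vector₂
  0ᵥ = ⟨ 0# , 0# ⟩

  infixr 7 _*ᵥ_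
  _*ᵥ_ : Carrier → Vector₂ → Vector₂
  s *ᵥ ⟨ x₁ , x₂ ⟩ = ⟨ s * x₁ , s * x₂ ⟩

  -- mat a b c d has rows (a b) and (c d).
  record Matrix₂ : Set c where
    constructor mat
    field
      m₁₁ m₁₂ m₂₁ m₂₂ : Carrier

  det : Matrix₂ → Carrier
  det (mat a b c d) = a * d - b * c

  _⊡_ : Matrix₂ → Matrix₂ → Matrix₂
  mat a b c d ⊡ mat a′ b′ c′ d′ =
    mat (a * a′ + b * c′) (a * b′ + b * d′)
        (c * a′ + d * c′) (c * b′ + d * d′)

  _⊡ᵥ_ : Matrix₂ → Vector₂ → Vector₂
  mat a b c d ⊡ᵥ ⟨ x₁ , x₂ ⟩ = ⟨ a * x₁ + b * x₂ , c * x₁ + d * x₂ ⟩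

  record SL₂ : Set (c ⊔ ℓ₁) where
    constructor _,det≈1_
    field
      matrix : Matrix₂
      det≈1  : det matrix ≈ 1#

  private
    det-⊡ : ∀ M N → det (M ⊡ N) ≈ det M * det N
    det-⊡ (mat a b c d) (mat a′ b′ c′ d′) = I.det-⊡ a b c d a′ b′ c′ d′

    det-1 : 1# * 1# - 0# * 0# ≈ 1#
    det-1 = begin
      1# * 1# - 0# * 0#  ≈⟨ +-cong (*-identityˡ 1#) (-‿cong (zeroˡ 0#)) ⟩
      1# - 0#            ≈⟨ +-congˡ -0#≈0# ⟩
      1# + 0#            ≈⟨ +-identityʳ 1# ⟩
      1#                 ∎
      where open ≈-Reasoning setoid

    det-letter : ∀ α → 0# * α - 1# * - 1# ≈ 1#
    det-letter α = begin
      0# * α - 1# * - 1#  ≈⟨ +-cong (zeroˡ α) (-‿cong (*-identityˡ (- 1#))) ⟩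
      0# - - 1#           ≈⟨ +-identityˡ (- - 1#) ⟩
      - - 1#              ≈⟨ -‿involutive 1# ⟩
      1#                  ∎
      where open ≈-Reasoning setoid

    adjugate : ∀ M v → det M ≈ 1# → M ⊡ᵥ v ≈ᵥ 0ᵥ → v ≈ᵥ 0ᵥ
    adjugate (mat a b c d) ⟨ x , y ⟩ dt (p , q) =
        (begin
          x                                             ≈⟨ *-identityˡ x ⟨
          1# * x                                        ≈⟨ *-congʳ dt ⟨
          (a * d - b * c) * x                           ≈⟨ I.first a b c d x y ⟩
          d * (a * x + b * y) - b * (c * x + d * y)     ≈⟨ +-cong (*-congˡ p) (-‿cong (*-congˡ q)) ⟩
          d * 0# - b * 0#                               ≈⟨ vanish d b ⟩
          0#                                            ∎)
      , (begin
          y                                             ≈⟨ *-identityˡ y ⟨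
          1# * y                                        ≈⟨ *-congʳ dt ⟨
          (a * d - b * c) * y                           ≈⟨ I.second a b c d x y ⟩
          a * (c * x + d * y) - c * (a * x + b * y)     ≈⟨ +-cong (*-congˡ q) (-‿cong (*-congˡ p)) ⟩
          a * 0# - c * 0#                               ≈⟨ vanish a c ⟩
          0#                                            ∎)
      where
      open ≈-Reasoning setoid
      vanish : ∀ s t → s * 0# - t * 0# ≈ 0#
      vanish s t = trans (+-cong (zeroʳ s) (-‿cong (zeroʳ t))) (-‿inverseʳ 0#)

  1ₛ : SL₂
  1ₛ = mat 1# 0# 0# 1# ,det≈1 det-1

  infixr 7 _·_
  _·_ : SL₂ → SL₂ → SL₂
  (M ,det≈1 p) · (N ,det≈1 q) =
    (M ⊡ N) ,det≈1 trans (det-⊡ M N) (trans (*-cong p q) (*-identityˡ 1#))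

  record NonzeroVector : Set (c ⊔ ℓ₁) where
    constructor _,≉0_
    field
      vector : Vector₂
      ≉0     : ¬ (vector ≈ᵥ 0ᵥ)

  infix 4 _∼_
  _∼_ : NonzeroVector → NonzeroVector → Set (c ⊔ ℓ₁)
  (v ,≉0 _) ∼ (w ,≉0 _) = ∃[ s ] IsUnit s × (v ≈ᵥ s *ᵥ w)

  P¹ : Setoid (c ⊔ ℓ₁) (c ⊔ ℓ₁)
  P¹ = record
    { Carrier       = NonzeroVector
    ; _≈_           = _∼_
    ; isEquivalence = record
      { refl  = 1# , (1# , *-identityˡ 1# , *-identityˡ 1#)
                   , (sym (*-identityˡ _) , sym (*-identityˡ _))
      ; sym   = λ { (s , (t , ts , st) , (p , q)) →
                    t , (s , st , ts) , (cancel ts p , cancel ts q) }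
      ; trans = λ { (s , (s⁻ , s⁻s , ss⁻) , (p , q)) (t , (t⁻ , t⁻t , tt⁻) , (p′ , q′)) →
                    s * t
                  , (t⁻ * s⁻ , inverses s⁻s t⁻t , inverses tt⁻ ss⁻)
                  , (compose p p′ , compose q q′) }
      }
    }
    where
    cancel : ∀ {s t x y} → t * s ≈ 1# → x ≈ s * y → y ≈ t * x
    cancel ts p =
      sym (trans (*-congˡ p) (trans (sym (*-assoc _ _ _)) (trans (*-congʳ ts) (*-identityˡ _))))
    compose : ∀ {s t x y z} → x ≈ s * y → y ≈ t * z → x ≈ (s * t) * z
    compose p p′ = trans p (trans (*-congˡ p′) (sym (*-assoc _ _ _)))
    inverses : ∀ {s s⁻ t t⁻} → s⁻ * s ≈ 1# → t⁻ * t ≈ 1# → (t⁻ * s⁻) * (s * t) ≈ 1#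
    inverses {s} {s⁻} {t} {t⁻} p q = begin
      (t⁻ * s⁻) * (s * t)  ≈⟨ *-assoc t⁻ s⁻ (s * t) ⟩
      t⁻ * (s⁻ * (s * t))  ≈⟨ *-congˡ (*-assoc s⁻ s t) ⟨
      t⁻ * ((s⁻ * s) * t)  ≈⟨ *-congˡ (*-congʳ p) ⟩
      t⁻ * (1# * t)        ≈⟨ *-congˡ (*-identityˡ t) ⟩
      t⁻ * t               ≈⟨ q ⟩
      1#                   ∎
      where open ≈-Reasoning setoid

  infixr 7 _•_
  _•_ : SL₂ → NonzeroVector → NonzeroVector
  (M ,det≈1 p) • (v ,≉0 v≉0) = (M ⊡ᵥ v) ,≉0 λ Mv≈0 → v≉0 (adjugate M v p Mv≈0)

  •-cong : ∀ M {v w} → v ∼ w → M • v ∼ M • w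
  •-cong (mat a b c d ,det≈1 _) (s , s-unit , (p , q)) =
    s , s-unit , (row a b , row c d)
    where
    row : ∀ a b → _ ≈ _
    row a b = trans (+-cong (*-congˡ p) (*-congˡ q)) (I.distribute a b s _ _)

  1≉0 : ¬ (1# ≈ 0#)
  1≉0 1≈0 = #-irrefl (refl {0#}) (invertible⇒#
    (0# , trans (zeroˡ _) (sym 1≈0) , trans (zeroʳ _) (sym 1≈0)))

  [0∶1] : NonzeroVector
  [0∶1] = ⟨ 0# , 1# ⟩ ,≉0 λ (_ , 1≈0) → 1≉0 1≈0

  [1∶_] : Carrier → NonzeroVector
  [1∶ r ] = ⟨ 1# , r ⟩ ,≉0 λ (1≈0 , _) → 1≉0 1≈0

  Word : Set c
  Word = List Carrier

  wordSetoid : Setoid c (c ⊔ ℓ₁)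
  wordSetoid = ListEquality.≋-setoid setoid

  letter : Carrier → SL₂
  letter α = mat 0# 1# (- 1#) α ,det≈1 det-letter α

  π : Word → SL₂
  π = foldr (λ α M → letter α · M) 1ₛ

  𝒜 : Carrier → Pred Word (c ⊔ ℓ₁)
  𝒜 r w = π w • [0∶1] ∼ [1∶ r ]

  𝒞 : Carrier → Pred Word (c ⊔ ℓ₁)
  𝒞 r = ∁ (𝒜 r)

  OfLength : ℕ → Pred Word _
  OfLength l w = length w ≡ l

  𝒜ˡ 𝒞ˡ : ℕ → Carrier → Setoid (c ⊔ ℓ₁) (c ⊔ ℓ₁)
  𝒜ˡ l r = subsetoid wordSetoid (OfLength l ∩ 𝒜 r)
  𝒞ˡ l r = subsetoid wordSetoid (OfLength l ∩ 𝒞 r)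

{-# OPTIONS --safe #-}
module Submission where

-- Write π(w)(0,1)ᵗ = (b,d)ᵗ. Prepending a letter α turns this vector into
-- (d, αd − b)ᵗ, which spans [1 : r] iff d is invertible and α = r + b/d. Since
-- det π(w) = 1, d is invertible iff w ∉ 𝒜₀. Hence 𝒜ᵣˡ⁺¹ is in bijection with 𝒞₀ˡ,
-- and both sizes follow by induction from |𝒜ᵣˡ| + |𝒞ᵣˡ| = qˡ.

open import Defs
open import Algebra.Apartness.Bundles using (HeytingField; HeytingCommutativeRing)
open import Algebra.Bundles using (CommutativeRing)
import Algebra.Properties.Group as GroupProperties
import Algebra.Properties.Ring as RingProperties
open import Data.Empty using (⊥-elim)
open import Data.Fin using (Fin; zero; suc; combine; remQuot)
open import Data.Fin.Permutation using (↔⇒≡)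
open import Data.Fin.Properties using (any?; combine-remQuot; remQuot-combine; suc-injective)
  renaming (_≟_ to _≟ᶠ_)
open import Data.Integer using (+_; -1ℤ; _^_; _+_; _-_)
import Data.Integer as ℤ
import Data.Integer.Properties as ℤ
open import Data.Integer.Tactic.RingSolver using (solve-∀)
open import Data.List using ([]; _∷_)
open import Data.List.Relation.Binary.Pointwise using ([]; _∷_)
open import Data.Nat using (ℕ; suc)
import Data.Nat as ℕ
import Data.Nat.Properties as ℕ
open import Data.Product using (∃; ∃-syntax; _×_; _,_; proj₁; proj₂; uncurry)
open import Data.Rational using (_/_)
open import Data.Rational.Properties using (fromℚᵘ-cong)
open import Data.Rational.Unnormalised using (mkℚᵘ; *≡*)
open import Function using (_∘_)
open import Function.Bundles using (Inverse; _⇔_; mk⇔; module Equivalence)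
import Function.Construct.Composition as Compose
import Function.Construct.Symmetry as Symmetry
open import Function.Properties.Inverse using (Inverse⇒Injection)
open import Level using (Level)
open import Relation.Binary.Bundles using (Setoid)
open import Relation.Binary.Definitions using (_Respects_)
open import Relation.Binary.PropositionalEquality as ≡ using (_≡_)
import Relation.Binary.Reasoning.Setoid as ≈-Reasoning
open import Relation.Nullary using (Dec; yes; no; ¬_; contradiction)
open import Relation.Nullary.Decidable using (decidable-stable; via-injection; _×-dec_)
import Relation.Nullary.Decidable as Dec
open import Relation.Unary using (Pred; Decidable; ∁; _∩_)

private variable
  a b ℓ ℓ′ p p′ : Level
  m n : ℕ

-- Inverses between setoids and between their subsetoids.

module _ (S : Setoid a ℓ) (T : Setoid b ℓ′) where
  private
    module S = Setoid S
    module T = Setoid T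

  -- The `inverse` field wants both laws up to equality of the arguments. The strict laws and the
  -- two congruences suffice for that.
  mkInverse : (to : S.Carrier → T.Carrier) (from : T.Carrier → S.Carrier) →
    (∀ {x y} → x S.≈ y → to x T.≈ to y) →
    (∀ {x y} → x T.≈ y → from x S.≈ from y) →
    (∀ y → to (from y) T.≈ y) → (∀ x → from (to x) S.≈ x) → Inverse S T
  mkInverse to from to-cong from-cong invˡ invʳ = record
    { to        = to
    ; from      = from
    ; to-cong   = to-cong
    ; from-cong = from-cong
    ; inverse   = (λ x≈fy → T.trans (to-cong x≈fy) (invˡ _))
                , (λ x≈ty → S.trans (from-cong x≈ty) (invʳ _))
    }

  -- With the predicate on `T` pulled back along `from`, the way back keeps the proof as it is. Only
  -- the way forth has to move it along `from (to x) ≈ x`.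
  subset-inverse : (S≅T : Inverse S T) {P : Pred S.Carrier p} → P Respects S._≈_ →
    Inverse (subsetoid S P) (subsetoid T (P ∘ Inverse.from S≅T))
  subset-inverse S≅T resp = record
    { to        = λ (x , px) → to x , resp (S.sym (strictlyInverseʳ x)) px
    ; from      = λ (y , py) → from y , py
    ; to-cong   = to-cong
    ; from-cong = from-cong
    ; inverse   = inverseˡ , inverseʳ
    }
    where open Inverse S≅T

HasSize-unique : (S : Setoid a ℓ) → HasSize S m → HasSize S n → m ≡ n
HasSize-unique S S≅m S≅n = ↔⇒≡ (Compose.inverse (Symmetry.inverse S≅m) S≅n)

empty-size : (S : Setoid a ℓ) → ¬ Setoid.Carrier S → HasSize S 0
empty-size S ∅ = mkInverse S (≡.setoid (Fin 0))
  (⊥-elim ∘ ∅) (λ ()) (λ {x} → ⊥-elim (∅ x)) (λ { {()} }) (λ ()) (⊥-elim ∘ ∅)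

-- Sizes of decidable subsets and of their complements.

module _ {P : Pred (Fin (suc n)) p} where
  private
    Tail Whole : Setoid _ _
    Tail  = subsetoid (≡.setoid (Fin n)) (P ∘ suc)
    Whole = subsetoid (≡.setoid (Fin (suc n))) P

  size-with-zero : P zero → HasSize Tail m → HasSize Whole (suc m)
  size-with-zero {m = m} p₀ Tail≅m = mkInverse Whole (≡.setoid (Fin (suc m)))
    to′ from′ to′-cong (λ { ≡.refl → ≡.refl }) invˡ invʳ
    where
    open Inverse Tail≅m
    to′ : ∃ P → Fin (suc m)
    to′ (zero  , _) = zero
    to′ (suc i , p) = suc (to (i , p))
    from′ : Fin (suc m) → ∃ P
    from′ zero    = zero , p₀
    from′ (suc j) = suc (proj₁ (from j)) , proj₂ (from j)
    to′-cong : ∀ {x y} → proj₁ x ≡ proj₁ y → to′ x ≡ to′ y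
    to′-cong {zero  , _} {zero  , _} _  = ≡.refl
    to′-cong {suc i , _} {suc j , _} eq = ≡.cong suc (to-cong (suc-injective eq))
    invˡ : ∀ j → to′ (from′ j) ≡ j
    invˡ zero    = ≡.refl
    invˡ (suc j) = ≡.cong suc (strictlyInverseˡ j)
    invʳ : ∀ x → proj₁ (from′ (to′ x)) ≡ proj₁ x
    invʳ (zero  , _) = ≡.refl
    invʳ (suc i , p) = ≡.cong suc (strictlyInverseʳ (i , p))

  size-without-zero : ¬ P zero → HasSize Tail m → HasSize Whole m
  size-without-zero {m = m} ¬p₀ Tail≅m = Compose.inverse Whole≅Tail Tail≅m
    where
    to′ : ∃ P → ∃ (P ∘ suc)
    to′ (zero  , p) = contradiction p ¬p₀
    to′ (suc i , p) = i , p
    to′-cong : ∀ {x y} → proj₁ x ≡ proj₁ y → proj₁ (to′ x) ≡ proj₁ (to′ y)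
    to′-cong {zero  , p} {_}         _  = contradiction p ¬p₀
    to′-cong {suc i , _} {suc j , _} eq = suc-injective eq
    invʳ : ∀ x → suc (proj₁ (to′ x)) ≡ proj₁ x
    invʳ (zero  , p) = contradiction p ¬p₀
    invʳ (suc i , _) = ≡.refl
    Whole≅Tail : Inverse Whole Tail
    Whole≅Tail = mkInverse Whole Tail
      to′ (λ (i , p) → suc i , p) (λ {x} {y} → to′-cong {x} {y})
      (≡.cong suc) (λ _ → ≡.refl) invʳ

-- Induction on `n`: deciding `P zero` shows which of the two sizes grows by one, and the other side
-- just shifts its indices.
partition-Fin : ∀ n {P : Pred (Fin n) p} → Decidable P →
  ∃[ a ] ∃[ b ] HasSize (subsetoid (≡.setoid (Fin n)) P) a
              × HasSize (subsetoid (≡.setoid (Fin n)) (∁ P)) b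
              × a ℕ.+ b ≡ n
partition-Fin ℕ.zero P? =
  0 , 0 , empty-size _ (λ ()) , empty-size _ (λ ()) , ≡.refl
partition-Fin (suc n) P? with P? zero | partition-Fin n (P? ∘ suc)
... | yes p₀ | a , b , A≅a , B≅b , a+b≡n =
  suc a , b , size-with-zero p₀ A≅a , size-without-zero (λ ¬p₀ → ¬p₀ p₀) B≅b
  , ≡.cong suc a+b≡n
... | no ¬p₀ | a , b , A≅a , B≅b , a+b≡n =
  a , suc b , size-without-zero ¬p₀ A≅a , size-with-zero ¬p₀ B≅b
  , ≡.trans (ℕ.+-suc a b) (≡.cong suc a+b≡n)

-- The partition of `Fin n` brings its own size for the `P` part. Uniqueness of sizes identifies it
-- with the given `m`.
complement-size : (S : Setoid a ℓ) {P : Pred (Setoid.Carrier S) p} →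
  Decidable P → P Respects Setoid._≈_ S →
  HasSize S n → HasSize (subsetoid S P) m →
  ∃[ b ] HasSize (subsetoid S (∁ P)) b × m ℕ.+ b ≡ n
complement-size {n = n} S {P} P? resp S≅n P≅m
  with partition-Fin n (P? ∘ Inverse.from S≅n)
... | a , b , A≅a , B≅b , a+b≡n =
  b
  , Compose.inverse (subset-inverse _ _ S≅n (λ x≈y ¬px py → ¬px (resp (Setoid.sym S x≈y) py))) B≅b
  , ≡.trans (≡.cong (ℕ._+ b) (HasSize-unique _ P≅m P≅a)) a+b≡n
  where
  P≅a = Compose.inverse (subset-inverse _ _ S≅n resp) A≅a

-- Lets words of length `l` in `𝒜 r` be seen as a subset of the words of length `l`, the finite set
-- in which complements are counted.
subset-∩-inverse : (S : Setoid a ℓ) {P : Pred (Setoid.Carrier S) p} {Q : Pred (Setoid.Carrier S) p′} →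
  Inverse (subsetoid S (P ∩ Q)) (subsetoid (subsetoid S P) (Q ∘ proj₁))
subset-∩-inverse S = mkInverse _ _
  (λ (x , px , qx) → (x , px) , qx) (λ ((x , px) , qx) → x , px , qx)
  (λ eq → eq) (λ eq → eq) (λ _ → Setoid.refl S) (λ _ → Setoid.refl S)

module FiniteField {c ℓ₁ ℓ₂ : Level} (k : HeytingField c ℓ₁ ℓ₂)
  (q : ℕ) (k≅q : HasSize (HeytingField.setoid k) q) where

  open HeytingField k hiding (zero) renaming (_+_ to _⊕_; _-_ to _⊖_; _*_ to _⊗_)
  open OverField k
  open Setoid wordSetoid using () renaming (_≈_ to _≋_; refl to ≋-refl)

  private
    commutativeRing : CommutativeRing c ℓ₁
    commutativeRing = HeytingCommutativeRing.commutativeRing heytingCommutativeRing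
  open RingProperties (CommutativeRing.ring commutativeRing) using (-1*x≈-x; -‿distribʳ-*; -0#≈0#)
  open GroupProperties (CommutativeRing.+-group commutativeRing)
    using (\\-leftDividesˡ; \\-leftDividesʳ)

  -- Decidable equality and invertibility in a finite field.

  infix 4 _≟_
  _≟_ : ∀ x y → Dec (x ≈ y)
  _≟_ = via-injection (Inverse⇒Injection k≅q) _≟ᶠ_

  IsUnit-resp : IsUnit Respects _≈_
  IsUnit-resp x≈y (x⁻ , x⁻x , xx⁻) =
    x⁻ , trans (*-congˡ (sym x≈y)) x⁻x , trans (*-congʳ (sym x≈y)) xx⁻

  ≈0⇒¬unit : ∀ {x} → x ≈ 0# → ¬ IsUnit x
  ≈0⇒¬unit x≈0 (x⁻ , x⁻x , _) =
    1≉0 (trans (sym x⁻x) (trans (*-congˡ x≈0) (zeroʳ x⁻)))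

  -- Apartness from `0#` would make `x - 0#`, hence `x`, invertible. So `x` is not apart from `0#`,
  -- and tightness gives equality.
  ¬unit⇒≈0 : ∀ {x} → ¬ IsUnit x → x ≈ 0#
  ¬unit⇒≈0 {x} ¬u = proj₁ (tight x 0#)
    (¬u ∘ IsUnit-resp (trans (+-congˡ -0#≈0#) (+-identityʳ x)) ∘ #⇒invertible)

  -- Tightness turns `x ≉ 0` only into the double negation of invertibility. The inverse itself is
  -- found by searching through the finitely many elements.
  unit? : Decidable IsUnit
  unit? x with x ≟ 0#
  ... | yes x≈0 = no (≈0⇒¬unit x≈0)
  ... | no x≉0 with any? (λ i → Inverse.from k≅q i ⊗ x ≟ 1#)
  ...   | yes (i , yx≈1) = yes (Inverse.from k≅q i , yx≈1 , trans (*-comm x _) yx≈1)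
  ...   | no ∄y = contradiction (¬unit⇒≈0 ¬unit) x≉0
    where
    ¬unit : ¬ IsUnit x
    ¬unit (y , yx≈1 , _) = ∄y (Inverse.to k≅q y ,
      trans (*-congʳ (Inverse.strictlyInverseʳ k≅q y)) yx≈1)

  *-cancelʳ-unit : ∀ {x y z} → IsUnit z → x ⊗ z ≈ y ⊗ z → x ≈ y
  *-cancelʳ-unit {x} {y} {z} (z⁻ , _ , zz⁻) xz≈yz = begin
    x               ≈⟨ undo x ⟨
    x ⊗ z ⊗ z⁻      ≈⟨ *-congʳ xz≈yz ⟩
    y ⊗ z ⊗ z⁻      ≈⟨ undo y ⟩
    y               ∎
    where
    open ≈-Reasoning setoid
    undo : ∀ u → u ⊗ z ⊗ z⁻ ≈ u
    undo u = trans (*-assoc u z z⁻) (trans (*-congˡ zz⁻) (*-identityʳ u))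

  -- The last column of `π w` and membership in `𝒜 r`.

  opaque
    -- The entries b and d of the overview. They are opaque so that later proofs use the recursion
    -- on words and not the unfolded matrix products.
    upper lower : Word → Carrier
    upper w = Matrix₂.m₁₂ (SL₂.matrix (π w))
    lower w = Matrix₂.m₂₂ (SL₂.matrix (π w))

    upper-[] : upper [] ≈ 0#
    upper-[] = refl

    upper-∷ : ∀ α w → upper (α ∷ w) ≈ lower w
    upper-∷ α w = trans (+-cong (zeroˡ _) (*-identityˡ _)) (+-identityˡ _)

    lower-∷ : ∀ α w → lower (α ∷ w) ≈ - upper w ⊕ α ⊗ lower w
    lower-∷ α w = +-congʳ (-1*x≈-x _)

    upper-cong : ∀ {w w′} → w ≋ w′ → upper w ≈ upper w′
    lower-cong : ∀ {w w′} → w ≋ w′ → lower w ≈ lower w′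
    upper-cong []            = refl
    upper-cong (_ ∷ w≋w′)    = +-cong (*-congˡ (upper-cong w≋w′)) (*-congˡ (lower-cong w≋w′))
    lower-cong []            = refl
    lower-cong (α≈α′ ∷ w≋w′) = +-cong (*-congˡ (upper-cong w≋w′)) (*-cong α≈α′ (lower-cong w≋w′))

    -- With d = 0 the determinant condition ad - bc = 1 reads b(-c) = 1, so -c is the inverse of b.
    lower≈0⇒upper-unit : ∀ w → lower w ≈ 0# → IsUnit (upper w)
    lower≈0⇒upper-unit w = det≈1⇒unit (SL₂.det≈1 (π w))
      where
      open ≈-Reasoning setoid
      det≈1⇒unit : ∀ {a b c d} → a ⊗ d ⊖ b ⊗ c ≈ 1# → d ≈ 0# → IsUnit b
      det≈1⇒unit {a} {b} {c} {d} det≈1 d≈0 = - c , trans (*-comm _ _) b[-c]≈1 , b[-c]≈1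
        where
        b[-c]≈1 : b ⊗ - c ≈ 1#
        b[-c]≈1 = begin
          b ⊗ - c            ≈⟨ -‿distribʳ-* b c ⟨
          - (b ⊗ c)          ≈⟨ +-identityˡ _ ⟨
          0# ⊖ b ⊗ c         ≈⟨ +-congʳ (zeroʳ a) ⟨
          a ⊗ 0# ⊖ b ⊗ c     ≈⟨ +-congʳ (*-congˡ d≈0) ⟨
          a ⊗ d ⊖ b ⊗ c      ≈⟨ det≈1 ⟩
          1#                 ∎

    -- The first coordinate of `[1∶ r ]` is 1, which forces the scalar in `∼` to be `upper w`. The
    -- second coordinate then gives the equation.
    𝒜⇔ : ∀ r w → 𝒜 r w ⇔ (IsUnit (upper w) × lower w ≈ upper w ⊗ r)
    𝒜⇔ r w = mk⇔
      (λ (s , u , p , q) →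
        let b≈s = trans (sym (second _ _)) (trans p (*-identityʳ s)) in
        IsUnit-resp (sym b≈s) u , trans (sym (second _ _)) (trans q (*-congʳ (sym b≈s))))
      (λ (u , d≈br) →
        upper w , u , trans (second _ _) (sym (*-identityʳ _)) , trans (second _ _) d≈br)
      where
      second : ∀ x y → x ⊗ 0# ⊕ y ⊗ 1# ≈ y
      second x y = trans (+-cong (zeroʳ x) (*-identityʳ y)) (+-identityˡ y)

  𝒜? : ∀ r → Decidable (𝒜 r)
  𝒜? r w = Dec.map′ (Equivalence.from (𝒜⇔ r w)) (Equivalence.to (𝒜⇔ r w))
    (unit? (upper w) ×-dec (lower w ≟ upper w ⊗ r))

  𝒜-resp : ∀ r → 𝒜 r Respects _≋_
  𝒜-resp r {w} {w′} w≋w′ w∈𝒜 =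
    let (u , eq) = Equivalence.to (𝒜⇔ r w) w∈𝒜 in Equivalence.from (𝒜⇔ r w′)
    ( IsUnit-resp (upper-cong w≋w′) u
    , trans (sym (lower-cong w≋w′)) (trans eq (*-congʳ (upper-cong w≋w′))))

  []∉𝒜 : ∀ r → ¬ 𝒜 r []
  []∉𝒜 r = ≈0⇒¬unit upper-[] ∘ proj₁ ∘ Equivalence.to (𝒜⇔ r [])

  -- For r = 0 the equation in `𝒜⇔` says that `lower w` vanishes, and then `upper w` is a unit
  -- automatically by the determinant. Decidability of units removes the double negation.
  𝒞₀⇔ : ∀ w → 𝒞 0# w ⇔ IsUnit (lower w)
  𝒞₀⇔ w = mk⇔ to from
    where
    to : 𝒞 0# w → IsUnit (lower w)
    to w∉𝒜 = decidable-stable (unit? (lower w)) λ ¬u →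
      w∉𝒜 (Equivalence.from (𝒜⇔ 0# w)
        (lower≈0⇒upper-unit w (¬unit⇒≈0 ¬u) , trans (¬unit⇒≈0 ¬u) (sym (zeroʳ _))))
    from : IsUnit (lower w) → 𝒞 0# w
    from u w∈𝒜 = ≈0⇒¬unit
      (trans (proj₂ (Equivalence.to (𝒜⇔ 0# w) w∈𝒜)) (zeroʳ _)) u

  -- This is α = r + b/d with the denominator d cleared.
  𝒜-∷⇔ : ∀ r α w →
    𝒜 r (α ∷ w) ⇔ (IsUnit (lower w) × α ⊗ lower w ≈ upper w ⊕ lower w ⊗ r)
  𝒜-∷⇔ r α w = mk⇔
    (λ αw∈𝒜 → let (u , eq) = Equivalence.to (𝒜⇔ r (α ∷ w)) αw∈𝒜 in
      IsUnit-resp (upper-∷ α w) u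
      , (begin
          α ⊗ lower w                                 ≈⟨ \\-leftDividesˡ (upper w) _ ⟨
          upper w ⊕ (- upper w ⊕ α ⊗ lower w)         ≈⟨ +-congˡ (lower-∷ α w) ⟨
          upper w ⊕ lower (α ∷ w)                     ≈⟨ +-congˡ eq ⟩
          upper w ⊕ upper (α ∷ w) ⊗ r                 ≈⟨ +-congˡ (*-congʳ (upper-∷ α w)) ⟩
          upper w ⊕ lower w ⊗ r                       ∎))
    (λ (u , eq) → Equivalence.from (𝒜⇔ r (α ∷ w))
      ( IsUnit-resp (sym (upper-∷ α w)) u
      , (begin
          lower (α ∷ w)                               ≈⟨ lower-∷ α w ⟩
          - upper w ⊕ α ⊗ lower w                     ≈⟨ +-congˡ eq ⟩
          - upper w ⊕ (upper w ⊕ lower w ⊗ r)         ≈⟨ \\-leftDividesʳ (upper w) _ ⟩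
          lower w ⊗ r                                 ≈⟨ *-congʳ (upper-∷ α w) ⟨
          upper (α ∷ w) ⊗ r                           ∎)))
    where open ≈-Reasoning setoid

  -- The bijection that removes the first letter.

  -- The unit d cancels from αd = b + dr. Tails are compared only up to `≋`, as the congruence of
  -- the inverse map requires.
  𝒜-head-unique : ∀ r {α α′} w w′ →
    𝒜 r (α ∷ w) → 𝒜 r (α′ ∷ w′) → w ≋ w′ → α ≈ α′
  𝒜-head-unique r {α} {α′} w w′ p p′ w≋w′ =
    let (u , eq) = Equivalence.to (𝒜-∷⇔ r α w) p
        (_ , eq′) = Equivalence.to (𝒜-∷⇔ r α′ w′) p′
    in *-cancelʳ-unit u (begin
    α ⊗ lower w                   ≈⟨ eq ⟩
    upper w ⊕ lower w ⊗ r         ≈⟨ +-cong (upper-cong w≋w′) (*-congʳ (lower-cong w≋w′)) ⟩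
    upper w′ ⊕ lower w′ ⊗ r       ≈⟨ eq′ ⟨
    α′ ⊗ lower w′                 ≈⟨ *-congˡ (lower-cong w≋w′) ⟨
    α′ ⊗ lower w                  ∎)
    where open ≈-Reasoning setoid

  𝒜-head : ∀ r w → 𝒞 0# w → ∃[ α ] 𝒜 r (α ∷ w)
  𝒜-head r w w∈𝒞 =
    let u@(d⁻ , d⁻d , _) = Equivalence.to (𝒞₀⇔ w) w∈𝒞
        -- The solution (b + dr)/d of the equation in `𝒜-∷⇔`.
        α = (upper w ⊕ lower w ⊗ r) ⊗ d⁻
    in α , Equivalence.from (𝒜-∷⇔ r α w)
      (u , trans (*-assoc _ d⁻ _) (trans (*-congˡ d⁻d) (*-identityʳ _)))

  𝒜ˡ-suc≅𝒞ˡ : ∀ l r → Inverse (𝒜ˡ (suc l) r) (𝒞ˡ l 0#)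
  𝒜ˡ-suc≅𝒞ˡ l r = mkInverse (𝒜ˡ (suc l) r) (𝒞ˡ l 0#) to from
    (λ {x} {y} → to-cong {x} {y}) (λ {x} {y} → from-cong {x} {y})
    (λ _ → ≋-refl) from∘to
    where
    to : Setoid.Carrier (𝒜ˡ (suc l) r) → Setoid.Carrier (𝒞ˡ l 0#)
    to (α ∷ w , len , p) = w , ℕ.suc-injective len
      , Equivalence.from (𝒞₀⇔ w) (proj₁ (Equivalence.to (𝒜-∷⇔ r α w) p))
    from : Setoid.Carrier (𝒞ˡ l 0#) → Setoid.Carrier (𝒜ˡ (suc l) r)
    from (w , len , p) = proj₁ (𝒜-head r w p) ∷ w , ≡.cong suc len , proj₂ (𝒜-head r w p)
    to-cong : ∀ {x y} → proj₁ x ≋ proj₁ y → proj₁ (to x) ≋ proj₁ (to y)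
    to-cong {_ ∷ _ , _} {_ ∷ _ , _} (_ ∷ eq) = eq
    from-cong : ∀ {x y} → proj₁ x ≋ proj₁ y → proj₁ (from x) ≋ proj₁ (from y)
    from-cong {w , _ , p} {w′ , _ , p′} eq =
      𝒜-head-unique r w w′ (proj₂ (𝒜-head r w p)) (proj₂ (𝒜-head r w′ p′)) eq ∷ eq
    from∘to : ∀ x → proj₁ (from (to x)) ≋ proj₁ x
    from∘to x@(α ∷ w , _ , p) =
      𝒜-head-unique r w w (proj₂ (proj₂ (from (to x)))) p ≋-refl ∷ ≋-refl

  -- Counting words of a given length and the complement.

  words-size : ∀ l → HasSize (subsetoid wordSetoid (OfLength l)) (q ℕ.^ l)
  words-size ℕ.zero = mkInverse _ _
    (λ _ → zero) (λ _ → [] , ≡.refl) (λ _ → ≡.refl) (λ _ → [])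
    (λ { zero → ≡.refl }) (λ { ([] , _) → [] })
  words-size (suc l) = mkInverse Words⁺ (≡.setoid (Fin (q ℕ.^ suc l))) to from
    (λ {x} {y} → to-cong {x} {y}) (λ { ≡.refl → ≋-refl }) to∘from from∘to
    where
    module K = Inverse k≅q
    module W = Inverse (words-size l)
    Words⁺ = subsetoid wordSetoid (OfLength (suc l))
    to : Setoid.Carrier Words⁺ → Fin (q ℕ.^ suc l)
    to (α ∷ w , len) = combine (K.to α) (W.to (w , ℕ.suc-injective len))
    cons : Fin q × Fin (q ℕ.^ l) → Setoid.Carrier Words⁺
    cons (i , j) = K.from i ∷ proj₁ (W.from j) , ≡.cong suc (proj₂ (W.from j))
    from : Fin (q ℕ.^ suc l) → Setoid.Carrier Words⁺
    from = cons ∘ remQuot (q ℕ.^ l)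
    to-cong : ∀ {x y} → proj₁ x ≋ proj₁ y → to x ≡ to y
    to-cong {_ ∷ _ , _} {_ ∷ _ , _} (α≈α′ ∷ eq) = ≡.cong₂ combine (K.to-cong α≈α′) (W.to-cong eq)
    to∘cons : ∀ ij → to (cons ij) ≡ uncurry combine ij
    -- The length proof has passed through `suc` and back, so the word is paired with another proof
    -- than in `W.from j`. Equality in the subsetoid sees only the word, hence `≋-refl`.
    to∘cons (i , j) = ≡.cong₂ combine (K.strictlyInverseˡ i) (W.inverseˡ ≋-refl)
    to∘from : ∀ i → to (from i) ≡ i
    to∘from i = ≡.trans (to∘cons (remQuot (q ℕ.^ l) i)) (combine-remQuot {q} (q ℕ.^ l) i)
    from∘to : ∀ x → proj₁ (from (to x)) ≋ proj₁ x
    from∘to (α ∷ w , len) = Setoid.trans Words⁺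
      {from (to (α ∷ w , len))} {cons (K.to α , W.to (w , len′))} {α ∷ w , len}
      (Setoid.reflexive Words⁺ (≡.cong cons (remQuot-combine (K.to α) (W.to (w , len′)))))
      (K.strictlyInverseʳ α ∷ W.strictlyInverseʳ (w , len′))
      where len′ = ℕ.suc-injective len

  𝒞ˡ-size : ∀ l r {a} → HasSize (𝒜ˡ l r) a → ∃[ b ] HasSize (𝒞ˡ l r) b × a ℕ.+ b ≡ q ℕ.^ l
  𝒞ˡ-size l r A≅a =
    let (b , C≅b , a+b≡qˡ) = complement-size (subsetoid wordSetoid (OfLength l))
          (𝒜? r ∘ proj₁) (𝒜-resp r) (words-size l)
          (Compose.inverse (Symmetry.inverse (subset-∩-inverse wordSetoid)) A≅a)
    in b , Compose.inverse (subset-∩-inverse wordSetoid) C≅b , a+b≡qˡ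

-- Arithmetic of the closed forms.

pos-^ : ∀ m n → + (m ℕ.^ n) ≡ (+ m) ^ n
pos-^ m ℕ.zero  = ≡.refl
pos-^ m (suc n) = ≡.trans (ℤ.pos-* m (m ℕ.^ n)) (≡.cong (+ m ℤ.*_) (pos-^ m n))

*≡⇒/≡ : ∀ i j n → i ℤ.* + suc n ≡ j → i / 1 ≡ j / suc n
-- `mkℚᵘ` stores the denominator minus one, so `0` and `n` encode the denominators 1 and `suc n`.
*≡⇒/≡ i j n eq = fromℚᵘ-cong {mkℚᵘ i 0} {mkℚᵘ j n} (*≡* (≡.trans eq (≡.sym (ℤ.*-identityʳ j))))

-- The identity (q+1)q^l - (q^l - e) = q^(l+1) + e with e = (-1)^l, kept free of denominators.
complement-count : ∀ a b q l → a ℕ.+ b ≡ q ℕ.^ l →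
  + a ℤ.* + suc q ≡ (+ q) ^ l - -1ℤ ^ l →
  + b ℤ.* + suc q ≡ (+ q) ^ suc l + -1ℤ ^ l
complement-count a b q l a+b≡qˡ eq = begin
  + b ℤ.* + suc q
    ≡⟨ difference (+ a) (+ b) (+ suc q) ⟩
  (+ a + + b) ℤ.* + suc q - + a ℤ.* + suc q
    ≡⟨ ≡.cong₂ (λ x y → x ℤ.* + suc q - y) (≡.trans (≡.cong +_ a+b≡qˡ) (pos-^ q l)) eq ⟩
  -- `+ suc q` computes to `+ 1 + + q`, the form in which the ring solver can treat `+ q` as a
  -- variable.
  (+ q) ^ l ℤ.* (+ 1 + + q) - ((+ q) ^ l - -1ℤ ^ l)
    ≡⟨ expand (+ q) ((+ q) ^ l) (-1ℤ ^ l) ⟩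
  (+ q) ^ suc l + -1ℤ ^ l ∎
  where
  open ≡.≡-Reasoning
  difference : ∀ x y z → y ℤ.* z ≡ (x + y) ℤ.* z - x ℤ.* z
  difference = solve-∀
  expand : ∀ x y z → y ℤ.* (+ 1 + x) - (y - z) ≡ x ℤ.* y + z
  expand = solve-∀

-- The induction on the length.

module _ {c ℓ₁ ℓ₂ : Level} (k : HeytingField c ℓ₁ ℓ₂)
  (q : ℕ) (k≅q : HasSize (HeytingField.setoid k) q) where
  open OverField k
  open FiniteField k q k≅q

  -- The size of `𝒜ˡ (suc l) r` is that of `𝒞ˡ l 0#` for every `r`, so the recursive call is always
  -- made at `0#`. Multiplying by q + 1 keeps the induction within the integers.
  𝒜ˡ-count : ∀ l r → ∃[ a ] HasSize (𝒜ˡ l r) a × + a ℤ.* + suc q ≡ (+ q) ^ l - -1ℤ ^ l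
  -- The empty word fixes `[0∶1]`, so it is not in `𝒜 r`; the formula agrees, as q^0 - (-1)^0 = 0.
  𝒜ˡ-count ℕ.zero r = 0 , empty-size _ (λ { ([] , _ , p) → []∉𝒜 r p }) , ≡.refl
  𝒜ˡ-count (suc l) r =
    let (a , A≅a , eq)     = 𝒜ˡ-count l (HeytingField.0# k)
        (b , C≅b , a+b≡qˡ) = 𝒞ˡ-size l (HeytingField.0# k) A≅a
    in b , Compose.inverse (𝒜ˡ-suc≅𝒞ˡ l r) C≅b
     -- The sign (-1)^l of the complement formula at `l` is -(-1)^(l+1), which gives the formula for
     -- `𝒜ˡ` at `suc l`.
     , ≡.trans (complement-count a b q l a+b≡qˡ eq) (negate ((+ q) ^ suc l) (-1ℤ ^ l))
    where
    negate : ∀ x y → x + y ≡ x - -1ℤ ℤ.* y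
    negate = solve-∀

corollary2p5 : ∀ {c ℓ₁ ℓ₂} (k : HeytingField c ℓ₁ ℓ₂) (let open OverField k)
    (q : ℕ) → HasSize (HeytingField.setoid k) q →
    (l : ℕ) (r : HeytingField.Carrier k) →
    (∃[ a ] HasSize (𝒜ˡ l r) a × (+ a / 1 ≡ ((+ q) ^ l - -1ℤ ^ l) / suc q))
    ×
    (∃[ b ] HasSize (𝒞ˡ l r) b × (+ b / 1 ≡ ((+ q) ^ suc l + -1ℤ ^ l) / suc q))
corollary2p5 k q k≅q l r =
  let (a , A≅a , eq)     = 𝒜ˡ-count k q k≅q l r
      (b , C≅b , a+b≡qˡ) = FiniteField.𝒞ˡ-size k q k≅q l r A≅a
  in (a , A≅a , *≡⇒/≡ (+ a) _ q eq)
   , (b , C≅b , *≡⇒/≡ (+ b) _ q (complement-count a b q l a+b≡qˡ eq))
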